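{- Let $\mathcal{C}$ be a shellable simplicial complex. Then any shelling $(F_1,\ldots,F_s)$ of $\mathcal{C}$ is stable.
   Context: A polytopal complex is a collection of (abstract) polytopes that contains the empty polytope $\emptyset$ (of dimension $-1$), is closed under taking faces, and in which any two members intersect in a common face of both. Its maximal members are its facets; it is pure if all facets have the same dimension; it is a simplicial complex if all facets are simplices. For a polytope $P$, $\mathcal{C}(P)$ is the complex of all faces of $P$ and $\mathcal{C}(\partial P)$ the complex of all proper faces; for a finite collection of polytopes, $\mathcal{C}(\{P_1,\dots,P_m\})=\mathcal{C}(P_1\cup\cdots\cup P_m)=\bigcup_i\mathcal{C}(P_i)$ (having no faces at all if the collection is empty). If $\mathcal{D}$ is a subcomplex of $\mathcal{C}$, $\mathcal{C}\setminus\mathcal{D}=\{P\in\mathcal{C}:P\notin\mathcal{D}\}$ is called a relative complex. A shelling of a pure $d$-dimensional polytopal complex $\mathcal{C}$ is a linear ordering $(F_1,\ldots,F_s)$ of its facets such that either $d=0$, or (1) $\mathcal{C}(\partial F_1)$ has a shelling, and (2) for $2\le j\le s$, $F_j\cap\bigcup_{i<j}F_i$ is nonempty and equals $G_1\cup\cdots\cup G_r$ for some shelling $(G_1,\ldots,G_r,\ldots,G_t)$ of $\mathcal{C}(\partial F_j)$ and some $r\in[t]$. A complex is shellable if it is pure and admits a shelling. For a polytope $P$, let $L(P)$ be its face lattice (all faces including $\emptyset$ and $P$, ordered by inclusion), $[F,P]$ the closed interval of faces containing $F$, ${}^\ast$ the dual poset, and $A(\cdot)$ the set of atoms of a poset with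 a least element. Thus $A([F,P]^\ast)$ is the set of facets of $P$ containing $F$ (empty if $F=P$, all facets if $F=\emptyset$), and $A(L(P)^\ast)$ is the set of all facets of $P$. The reciprocal domains associated to a face $F$ of $P$ are the relative complexes $$\mathcal{C}(P)\setminus\mathcal{C}(A([F,P]^\ast))\quad\text{and}\quad \mathcal{C}(P)\setminus\mathcal{C}(A(L(P)^\ast)\setminus A([F,P]^\ast)).$$ A relative complex is stable if it is isomorphic to one of the reciprocal domains associated to some face $F$ (possibly $\emptyset$ or $P$) of some polytope $P$; here $\mathcal{C}\setminus\mathcal{D}$ and $\mathcal{C}'\setminus\mathcal{D}'$ are isomorphic if there is an inclusion-preserving (both ways) bijection $\mathcal{C}\to\mathcal{C}'$ mapping $\mathcal{D}$ onto $\mathcal{D}'$. A shelling $(F_1,\ldots,F_s)$ of $\mathcal{C}$ is stable if for all $i\in[s]$ the relative complex $\mathcal{R}_i=\mathcal{C}(F_i)\setminus\mathcal{C}(F_1\cup\cdots\cup F_{i-1})$, viewed as $\mathcal{C}(F_i)$ minus its subcomplex $\mathcal{C}(F_i)\cap\bigcup_{k<i}\mathcal{C}(F_k)$, is stable. -}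

module Defs where

open import Data.Fin using (Fin; toℕ)
open import Data.Fin.Subset.Properties using (⊆-poset)
open import Data.Integer as ℤ using (ℤ; 0ℤ; -1ℤ; +_)
open import Data.Nat as ℕ using (ℕ)
open import Data.Product using (Σ-syntax; ∃; ∃-syntax; _×_; _,_; proj₁; proj₂)
open import Data.Sum using (_⊎_)
open import Function.Bundles using (_⇔_; Inverse)
open import Function.Definitions using (Injective)
open import Level using (0ℓ)
open import Relation.Binary.Bundles using (Poset)
open import Relation.Binary.Construct.Closure.Equivalence using (EqClosure)
import Relation.Binary.Construct.NonStrictToStrict as ToStrict
import Relation.Binary.Construct.On as On
open import Relation.Binary.Definitions using (Minimum)
open import Relation.Binary.Lattice.Bundles using (MeetSemilattice)
open import Relation.Binary.Lattice.Structures using (IsBoundedLattice)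
open import Relation.Binary.Morphism.Structures using (IsOrderIsomorphism)
open import Relation.Binary.PropositionalEquality using (_≡_; setoid)
open import Relation.Nullary using (¬_)
open import Relation.Unary using (Pred; U)

module Order (P : Poset 0ℓ 0ℓ 0ℓ) where
  open Poset P
  open ToStrict _≈_ _≤_ public using (_<_)

  infix 4 _⋖_

  _⋖_ : Carrier → Carrier → Set
  x ⋖ y = x < y × (∀ z → ¬ (x < z × z < y))

  Between : Carrier → Carrier → Set
  Between x y = Σ[ z ∈ Carrier ] x < z × z < y

  -- The closed interval of all elements below x, with the induced order.
  ↓ : Carrier → Poset 0ℓ 0ℓ 0ℓ
  ↓ x = On.poset P (proj₁ {B = _≤ x})

Isomorphic : Poset 0ℓ 0ℓ 0ℓ → Poset 0ℓ 0ℓ 0ℓ → Set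
Isomorphic P Q = ∃ (IsOrderIsomorphism P._≈_ Q._≈_ P._≤_ Q._≤_)
  where module P = Poset P
        module Q = Poset Q

-- Abstract polytopes, in the sense of McMullen and Schulte: a polytope is given
-- by its poset of faces, including the empty face 𝟘 and the polytope 𝟙 itself.
-- In a polytopal complex any two faces must intersect in a common face, so the
-- face poset is moreover required to be a lattice; and polytopes are finite.

record IsPolytope (P : Poset 0ℓ 0ℓ 0ℓ) : Set where
  open Poset P
  open Order P
  field
    size             : ℕ
    finite           : Inverse (setoid (Fin size)) Eq.setoid
    _∨_ _∧_          : Carrier → Carrier → Carrier
    𝟘 𝟙              : Carrier
    isBoundedLattice : IsBoundedLattice _≈_ _≤_ _∨_ _∧_ 𝟙 𝟘
    dim              : Carrier → ℤ
    dim-𝟘            : dim 𝟘 ≡ -1ℤ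
    dim-<            : ∀ {x y} → x < y → dim x ℤ.< dim y
    dim-⋖            : ∀ {x y} → x ⋖ y → dim y ≡ ℤ.suc (dim x)
    diamond          : ∀ {x y} → x < y → dim y ≡ + 2 ℤ.+ dim x →
                       Σ[ a ∈ Between x y ] Σ[ b ∈ Between x y ]
                         (¬ proj₁ a ≈ proj₁ b) ×
                         (∀ (c : Between x y) → proj₁ c ≈ proj₁ a ⊎ proj₁ c ≈ proj₁ b)
    -- Every section y/x of dimension dim y - dim x - 1 ≥ 2 is connected: any two of
    -- its proper faces are joined by a sequence of successively incident ones.
    connected        : ∀ {x y} → x < y → + 3 ℤ.+ dim x ℤ.≤ dim y →
                       (a b : Between x y) →
                       EqClosure (λ (c d : Between x y) → proj₁ c ≤ proj₁ d) a b

record Polytope : Set₁ where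
  field
    faces      : Poset 0ℓ 0ℓ 0ℓ
    isPolytope : IsPolytope faces

  open Poset faces public
  open Order faces public
  open IsPolytope isPolytope public

  dimension : ℤ
  dimension = dim 𝟙

-- The face lattice of a simplex is the lattice of all subsets of its vertex set.
IsSimplex : Polytope → Set
IsSimplex P = ∃[ n ] Isomorphic (Polytope.faces P) (⊆-poset n)

-- A complex is given by the poset of its members, ordered by "is a face of".  The
-- member x is the polytope whose faces are the elements below x, so closure under
-- taking faces is built in, and the intersection of two members is their meet.

record PolytopalComplex : Set₁ where
  field
    meetSemilattice : MeetSemilattice 0ℓ 0ℓ 0ℓ

  open MeetSemilattice meetSemilattice public
  open Order poset public

  field
    ∅          : Carrier
    ∅-min      : Minimum _≤_ ∅
    isPolytope : ∀ x → IsPolytope (↓ x)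

  polytope : Carrier → Polytope
  polytope x = record { faces = ↓ x ; isPolytope = isPolytope x }

  dim : Carrier → ℤ
  dim x = Polytope.dimension (polytope x)

-- Subcomplexes of K are represented by predicates on its members; K itself is U.

module _ (K : PolytopalComplex) where
  open PolytopalComplex K

  Facet : Pred Carrier 0ℓ → Pred Carrier 0ℓ
  Facet D x = D x × (∀ y → D y → x ≤ y → x ≈ y)

  Pure : ℤ → Pred Carrier 0ℓ → Set
  Pure d D = ∀ x → Facet D x → dim x ≡ d

  IsSimplicial : Set
  IsSimplicial = ∀ x → Facet U x → IsSimplex (polytope x)

  ∂ : Carrier → Pred Carrier 0ℓ
  ∂ x y = y < x

  -- Initial F r is the subcomplex 𝒞(F₁ ∪ ⋯ ∪ F_r), i.e. generated by the first r
  -- terms of F.  Since indices start at zero, the terms preceding F j generate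
  -- Initial F (toℕ j).
  Initial : ∀ {s} → (Fin s → Carrier) → ℕ → Pred Carrier 0ℓ
  Initial F r x = ∃[ i ] toℕ i ℕ.< r × x ≤ F i

  record IsFacetOrdering (D : Pred Carrier 0ℓ) {s : ℕ} (F : Fin s → Carrier) : Set where
    field
      facet    : ∀ i → Facet D (F i)
      distinct : Injective _≡_ _≈_ F
      complete : ∀ x → Facet D x → ∃[ i ] x ≈ F i

  -- The (-1)-dimensional complex {∅} is treated like the 0-dimensional ones: its
  -- only ordering of facets is a shelling.
  data IsShelling (D : Pred Carrier 0ℓ) {s : ℕ} (F : Fin s → Carrier) : Set₁ where
    low  : ∀ d → d ℤ.≤ 0ℤ → Pure d D → IsFacetOrdering D F → IsShelling D F
    high : ∀ d → 0ℤ ℤ.< d → Pure d D → IsFacetOrdering D F →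
           (∀ j → toℕ j ≡ 0 →
              Σ[ t ∈ ℕ ] Σ[ G ∈ (Fin t → Carrier) ] IsShelling (∂ (F j)) G) →
           (∀ j → 1 ℕ.≤ toℕ j →
              (∃[ x ] (¬ x ≈ ∅) × x ≤ F j × Initial F (toℕ j) x) ×
              (Σ[ t ∈ ℕ ] Σ[ G ∈ (Fin t → Carrier) ] IsShelling (∂ (F j)) G ×
                 (∃[ r ] 1 ℕ.≤ r × r ℕ.≤ t ×
                    (∀ x → (x ≤ F j × Initial F (toℕ j) x) ⇔ Initial G r x)))) →
           IsShelling D F

  IsShellable : Set₁
  IsShellable = (∃[ d ] Pure d U) × (Σ[ s ∈ ℕ ] Σ[ F ∈ (Fin s → Carrier) ] IsShelling U F)

-- A relative complex 𝒞 ∖ 𝒟.  Both kinds of relative complexes below have 𝒞 = 𝒞(P)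
-- for a polytope P, so the poset of faces of P stands for 𝒞.

record RelativeComplex : Set₁ where
  field
    total : Polytope
  open Polytope total
  field
    sub        : Pred Carrier 0ℓ
    sub-closed : ∀ {x y} → x ≤ y → sub y → sub x

infix 4 _≅_

_≅_ : RelativeComplex → RelativeComplex → Set
R ≅ S = Σ[ f ∈ (C.Carrier → D.Carrier) ]
          IsOrderIsomorphism C._≈_ D._≈_ C._≤_ D._≤_ f ×
          (∀ x → RelativeComplex.sub R x ⇔ RelativeComplex.sub S (f x))
  where module C = Polytope (RelativeComplex.total R)
        module D = Polytope (RelativeComplex.total S)

module _ (P : Polytope) where
  open Polytope P

  -- A(L(P)*): the atoms of the dual of the face lattice.
  Facets : Pred Carrier 0ℓ
  Facets G = G ⋖ 𝟙

  -- A([F , P]*)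
  FacetsContaining : Carrier → Pred Carrier 0ℓ
  FacetsContaining F G = F ≤ G × G ⋖ 𝟙

  -- 𝒞(P) ∖ 𝒞(𝒢) for a set 𝒢 of faces of P.
  Without : Pred Carrier 0ℓ → RelativeComplex
  Without 𝒢 = record
    { total      = P
    ; sub        = λ x → ∃[ G ] 𝒢 G × x ≤ G
    ; sub-closed = λ x≤y (G , g , y≤G) → G , g , trans x≤y y≤G
    }

  reciprocal₁ reciprocal₂ : Carrier → RelativeComplex
  reciprocal₁ F = Without (FacetsContaining F)
  reciprocal₂ F = Without (λ G → Facets G × ¬ FacetsContaining F G)

Stable : RelativeComplex → Set₁
Stable R = Σ[ P ∈ Polytope ] Σ[ F ∈ Polytope.Carrier P ]
             (R ≅ reciprocal₁ P F ⊎ R ≅ reciprocal₂ P F)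

module _ (K : PolytopalComplex) where
  open PolytopalComplex K

  -- 𝓡 F i is 𝒞(F i) minus its intersection with the union of the 𝒞(F k), k < i.
  𝓡 : ∀ {s} → (Fin s → Carrier) → Fin s → RelativeComplex
  𝓡 F i = record
    { total      = polytope (F i)
    ; sub        = λ x → Initial K F (toℕ i) (proj₁ x)
    ; sub-closed = λ x≤y (k , k<i , y≤Fk) → k , k<i , trans x≤y y≤Fk
    }

  IsStableShelling : ∀ {s} → (Fin s → Carrier) → Set₁
  IsStableShelling F = IsShelling K U F × (∀ i → Stable (𝓡 F i))

{-# OPTIONS --safe #-}

-- The facets of a simplex P correspond to its vertices by complementation, so for any
-- set 𝒢 of facets of P the facets containing the face ⋂ 𝒢 are exactly the members
-- of 𝒢.  Hence 𝒞(P) ∖ 𝒞(𝒢) is the first reciprocal domain associated to ⋂ 𝒢.  In a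
-- shelling, F_j meets the preceding facets in a union of facets of F_j.

module Submission where

open import Data.Bool using (true)
open import Data.Fin using (Fin; zero; toℕ; fromℕ<)
open import Data.Fin.Properties using (all?; ¬∀⟶∃¬; toℕ-fromℕ<; toℕ<n; <⇒≢)
open import Data.Fin.Subset using (Subset; _∈_; _∉_; _⊆_; _∪_; ⊤)
open import Data.Fin.Subset.Properties
  using (_∈?_; _⊆?_; p⊆p∪q; q⊆p∪q; x∈p∪q⁻; ∈⊤)
open import Data.Integer as ℤ using (0ℤ)
import Data.Integer.Properties as ℤ
open import Data.Nat as ℕ using (ℕ)
import Data.Nat.Properties as ℕ
open import Data.Product using (∃-syntax; _×_; _,_; proj₁; proj₂)
open import Data.Sum using (inj₁; [_,_])
open import Data.Unit using (tt)
open import Data.Vec using (tabulate)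
open import Data.Vec.Properties using (lookup∘tabulate; lookup⇒[]=; []=⇒lookup)
open import Function.Base using (_∘_; id)
open import Function.Bundles using (_⇔_; mk⇔; module Equivalence)
open import Level using (0ℓ)
open import Relation.Binary.Lattice.Structures using (module IsBoundedLattice)
import Relation.Binary.Morphism.Construct.Identity as Identity
open import Relation.Binary.Morphism.Structures using (module IsOrderIsomorphism)
open import Relation.Binary.PropositionalEquality using (_≡_; sym; trans; subst)
open import Relation.Nullary using (¬_; Dec; yes; no; does; contradiction)
open import Relation.Nullary.Decidable
  using (map′; decidable-stable; dec-true; _→-dec_)
open import Relation.Unary using (Pred; Decidable; U)
open import Relation.Unary.Properties using (U?)
open import Defs

comprehension : ∀ {n} {Q : Pred (Fin n) 0ℓ} → Decidable Q → ∃[ S ] (∀ v → v ∈ S ⇔ Q v)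
comprehension {Q = Q} Q? = tabulate (does ∘ Q?) , λ v → mk⇔
  (λ v∈S → does⇒ (Q? v) (trans (sym (lookup∘tabulate (does ∘ Q?) v)) ([]=⇒lookup v∈S)))
  (λ q → lookup⇒[]= v _ (trans (lookup∘tabulate (does ∘ Q?) v) (dec-true (Q? v) q)))
  where
  does⇒ : ∀ {v} (d : Dec (Q v)) → does d ≡ true → Q v
  does⇒ (yes q) _ = q

module Bounds (P : Polytope) where
  open Polytope P
  open IsBoundedLattice isBoundedLattice public using (maximum; minimum)

module Simplex (P : Polytope) (simplex : IsSimplex P) where
  open Polytope P renaming (trans to ≤-trans)
  open Bounds P

  private
    f = proj₁ (proj₂ simplex)
    open IsOrderIsomorphism (proj₂ (proj₂ simplex)) using (mono; cancel; surjective)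

    f⁻¹ : Subset (proj₁ simplex) → Carrier
    f⁻¹ S = proj₁ (surjective S)

    f-f⁻¹ : ∀ S → f (f⁻¹ S) ≡ S
    f-f⁻¹ S = proj₂ (surjective S) Eq.refl

    ≤f⁻¹ : ∀ {x S} → f x ⊆ S → x ≤ f⁻¹ S
    ≤f⁻¹ {x} {S} fx⊆S = cancel (subst (f x ⊆_) (sym (f-f⁻¹ S)) fx⊆S)

    f⁻¹≤ : ∀ {x S} → S ⊆ f x → f⁻¹ S ≤ x
    f⁻¹≤ {x} {S} S⊆fx = cancel (subst (_⊆ f x) (sym (f-f⁻¹ S)) S⊆fx)

  -- Inclusion of vertex sets is decidable, and `f` transports this to faces. It removes the double
  -- negations in `⋖𝟙-maximal` and `proper⇒≤𝟘`.
  _≤?_ : ∀ x y → Dec (x ≤ y)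
  x ≤? y = map′ cancel mono (f x ⊆? f y)

  ⋖𝟙-maximal : ∀ {x y} → x ⋖ 𝟙 → x ≤ y → y < 𝟙 → y ≤ x
  ⋖𝟙-maximal {x} {y} (_ , nothing-between) x≤y y<𝟙 = decidable-stable (y ≤? x) λ y≰x →
    nothing-between y ((x≤y , y≰x ∘ reflexive ∘ Eq.sym) , y<𝟙)

  private
    missing-vertex⇒<𝟙 : ∀ {x v} → v ∉ f x → x < 𝟙
    missing-vertex⇒<𝟙 {x} {v} v∉fx = maximum x , λ x≈𝟙 → v∉fx
      (mono (reflexive (Eq.sym x≈𝟙))
        (mono (maximum (f⁻¹ ⊤)) (subst (v ∈_) (sym (f-f⁻¹ ⊤)) ∈⊤)))

    missing-vertex : ∀ {x} → x < 𝟙 → ∃[ v ] v ∉ f x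
    missing-vertex {x} (_ , x≉𝟙) = ¬∀⟶∃¬ _ _ (_∈? f x) λ all →
      x≉𝟙 (antisym (maximum x) (cancel (λ {v} _ → all v)))

    -- A facet of a simplex lacks a single vertex: the face spanned by the vertices of `x` and `c`
    -- still misses `v`, so it is proper; it contains the facet `c`, so it is no larger than `c`.
    missing-vertex-≤ : ∀ {x c v} → c ⋖ 𝟙 → v ∉ f c → v ∉ f x → x ≤ c
    missing-vertex-≤ {x} {c} {v} c⋖𝟙 v∉fc v∉fx =
      ≤-trans (≤f⁻¹ (p⊆p∪q (f c)))
        (⋖𝟙-maximal c⋖𝟙 (≤f⁻¹ (q⊆p∪q (f x) (f c)))
          (missing-vertex⇒<𝟙 λ v∈ →
            [ v∉fx , v∉fc ] (x∈p∪q⁻ (f x) (f c) (subst (v ∈_) (f-f⁻¹ _) v∈))))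

  -- Here `m` is the intersection of the selected `G i`, and `S` is the set of their common
  -- vertices. A vertex missing from a facet `c` above `m` is not in `S`, so some selected `G i`
  -- misses it too and therefore lies in `c`.
  facets-above-meet : ∀ {t} (G : Fin t → Carrier) {Q : Pred (Fin t) 0ℓ} → Decidable Q →
    ∃[ m ] (∀ i → Q i → m ≤ G i) ×
           (∀ c → c ⋖ 𝟙 → m ≤ c → ∃[ i ] Q i × G i ≤ c)
  facets-above-meet {t} G {Q} Q? = f⁻¹ S , (λ i q → f⁻¹≤ λ v∈S → to v∈S i q) , above
    where
    inAll? : ∀ v → Dec (∀ i → Q i → v ∈ f (G i))
    inAll? v = all? λ i → Q? i →-dec (v ∈? f (G i))

    S = proj₁ (comprehension inAll?)

    to : ∀ {v} → v ∈ S → ∀ i → Q i → v ∈ f (G i)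
    to {v} = Equivalence.to (proj₂ (comprehension inAll?) v)

    above : ∀ c → c ⋖ 𝟙 → f⁻¹ S ≤ c → ∃[ i ] Q i × G i ≤ c
    above c c⋖𝟙 m≤c with missing-vertex (proj₁ c⋖𝟙)
    ... | v , v∉fc with ¬∀⟶∃¬ t _ (λ i → Q? i →-dec (v ∈? f (G i)))
                          (λ all → v∉fc (mono m≤c (subst (v ∈_) (sym (f-f⁻¹ S))
                            (Equivalence.from (proj₂ (comprehension inAll?) v) all))))
    ...   | i , ¬q→v∈ = i , q , missing-vertex-≤ c⋖𝟙 v∉fc (λ v∈ → ¬q→v∈ (λ _ → v∈))
      -- The failed implication yields only the double negation of `Q i`.
      where q = decidable-stable (Q? i) λ ¬q → ¬q→v∈ (λ q → contradiction q ¬q)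

module _ (R : RelativeComplex) where
  open RelativeComplex R
  open Polytope total renaming (trans to ≤-trans)

  -- The identity is an isomorphism onto the first reciprocal domain of the intersection `m` of the
  -- selected facets, because the facets above `m` are, up to `_≈_`, the selected ones.
  simplex-minus-facets-stable : IsSimplex total →
    ∀ {t} (G : Fin t → Carrier) {Q : Pred (Fin t) 0ℓ} → Decidable Q → (∀ i → G i ⋖ 𝟙) →
    (∀ x → sub x ⇔ (∃[ i ] Q i × x ≤ G i)) → Stable R
  simplex-minus-facets-stable simplex G Q? G⋖𝟙 sub⇔ =
    total , m , inj₁ (id , Identity.isOrderIsomorphism _≈_ _≤_ Eq.refl , λ x → mk⇔
      (λ s → let i , q , x≤Gi = Equivalence.to (sub⇔ x) s
             in G i , (m≤G i q , G⋖𝟙 i) , x≤Gi)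
      -- Some selected `G i` lies in `c`; as `G i` is itself a facet and `c` is proper, `c` lies in
      -- `G i` as well.
      (λ (c , (m≤c , c⋖𝟙) , x≤c) →
         let i , q , Gi≤c = above c c⋖𝟙 m≤c
         in Equivalence.from (sub⇔ x)
              (i , q , ≤-trans x≤c (⋖𝟙-maximal (G⋖𝟙 i) Gi≤c (proj₁ c⋖𝟙)))))
    where
    open Simplex total simplex
    meet = facets-above-meet G Q?
    m = proj₁ meet
    m≤G = proj₁ (proj₂ meet)
    above = proj₂ (proj₂ meet)

module _ (K : PolytopalComplex) where
  open PolytopalComplex K renaming (refl to ≤-refl; trans to ≤-trans)

  shelling⇒facetOrdering : ∀ {D s} {F : Fin s → Carrier} →
    IsShelling K D F → IsFacetOrdering K D F
  shelling⇒facetOrdering (low _ _ _ ordering)      = ordering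
  shelling⇒facetOrdering (high _ _ _ ordering _ _) = ordering

  -- The top of `↓ x` is a field of `IsPolytope`, not `x` by definition; the two agree because the
  -- top is above `(x , ≤-refl)`.
  ≥𝟙⇒≈ : ∀ {x} (y : Polytope.Carrier (polytope x)) →
    proj₁ (Polytope.𝟙 (polytope x)) ≤ proj₁ y → proj₁ y ≈ x
  ≥𝟙⇒≈ {x} (y , y≤x) 𝟙≤y =
    antisym y≤x (≤-trans (Bounds.maximum (polytope x) (x , ≤-refl)) 𝟙≤y)

  ∂-facet⇒⋖𝟙 : ∀ {x y} → Facet K (∂ K x) y → (y≤x : y ≤ x) →
    Polytope._⋖_ (polytope x) (y , y≤x) (Polytope.𝟙 (polytope x))
  ∂-facet⇒⋖𝟙 {x} {y} ((_ , y≉x) , y-max) y≤x =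
    (maximum (y , y≤x) , λ y≈𝟙 → y≉x (≥𝟙⇒≈ (y , y≤x) (reflexive (Eq.sym y≈𝟙)))) ,
    λ (z , z≤x) ((y≤z , y≉z) , (z≤𝟙 , z≉𝟙)) →
      y≉z (y-max z (z≤x , λ z≈x →
        z≉𝟙 (antisym z≤𝟙 (≤-trans (proj₂ 𝟙) (reflexive (Eq.sym z≈x))))) y≤z)
    where
    open Bounds (polytope x)
    open Polytope (polytope x) using (𝟙)

  module _ (simplicial : IsSimplicial K) {s} (F : Fin s → Carrier)
           (ordering : IsFacetOrdering K U F) where
    open IsFacetOrdering ordering

    private
      simplex : ∀ j → IsSimplex (polytope (F j))
      simplex j = simplicial (F j) (facet j)

    𝓡-first-stable : ∀ j → toℕ j ≡ 0 → Stable (𝓡 K F j)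
    𝓡-first-stable j j≡0 =
      -- The empty family of facets: its intersection is the whole polytope, and nothing is removed.
      simplex-minus-facets-stable (𝓡 K F j) (simplex j) {0} (λ ()) {λ ()} (λ ()) (λ ())
        λ x → mk⇔ (λ (k , k<j , _) → contradiction (subst (toℕ k ℕ.<_) j≡0 k<j) ℕ.n≮0)
                  (λ ())

    -- In dimension at most 0 a shelling imposes no intersection condition. The only proper face of
    -- `F j` is the empty face, so this is its single facet, and it is all that `F j` shares with
    -- earlier facets.
    𝓡-low-stable : ∀ j → dim (F j) ℤ.≤ 0ℤ → 1 ℕ.≤ toℕ j → Stable (𝓡 K F j)
    𝓡-low-stable j dim≤0 0<j =
      simplex-minus-facets-stable (𝓡 K F j) (simplex j) {1} (λ _ → P.𝟘) {U} U? (λ _ → 𝟘⋖𝟙)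
        λ x → mk⇔ (λ (k , k<j , x≤Fk) → zero , tt , proper⇒≤𝟘 x (maximum x , λ x≈𝟙 →
                     F-antichain k<j
                       (≤-trans (reflexive (Eq.sym (≥𝟙⇒≈ x (reflexive (Eq.sym x≈𝟙))))) x≤Fk)))
                  (λ (_ , _ , x≤𝟘) → first , first<j , ≤-trans x≤𝟘 𝟘≤first)
      where
      module P = Polytope (polytope (F j))
      open Bounds (polytope (F j))
      open Simplex (polytope (F j)) (simplex j)

      F-antichain : ∀ {k} → toℕ k ℕ.< toℕ j → ¬ F j ≤ F k
      F-antichain {k} k<j Fj≤Fk =
        <⇒≢ k<j (sym (distinct (proj₂ (facet j) (F k) tt Fj≤Fk)))

      0<s = ℕ.<-trans 0<j (toℕ<n j)
      first = fromℕ< 0<s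

      first<j : toℕ first ℕ.< toℕ j
      first<j = subst (ℕ._< toℕ j) (sym (toℕ-fromℕ< 0<s)) 0<j

      𝟘≤first : proj₁ P.𝟘 ≤ F first
      𝟘≤first = ≤-trans (minimum (∅ , ∅-min (F j))) (∅-min (F first))

      -- Otherwise `dim x` would be an integer strictly between -1 and a number at most 0.
      proper⇒≤𝟘 : ∀ x → x P.< P.𝟙 → x P.≤ P.𝟘
      proper⇒≤𝟘 x x<𝟙 = decidable-stable (x ≤? P.𝟘) λ x≰𝟘 →
        let -1<dim = subst (ℤ._< P.dim x) P.dim-𝟘
                       (P.dim-< {P.𝟘} {x} (minimum x , x≰𝟘 ∘ reflexive ∘ Eq.sym))
        in ℤ.<⇒≱ (ℤ.<-≤-trans (P.dim-< {x} x<𝟙) dim≤0) (ℤ.i<j⇒suc[i]≤j -1<dim)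

      𝟘⋖𝟙 : P.𝟘 P.⋖ P.𝟙
      -- If `F j` were the empty face, it would lie below the earlier facet `first`, so dimension -1
      -- is excluded.
      𝟘⋖𝟙 = (maximum P.𝟘 , λ 𝟘≈𝟙 → F-antichain first<j
               (≤-trans (reflexive (Eq.sym (≥𝟙⇒≈ P.𝟘 (reflexive (Eq.sym 𝟘≈𝟙))))) 𝟘≤first)) ,
            λ z ((𝟘≤z , 𝟘≉z) , z<𝟙) → 𝟘≉z (antisym 𝟘≤z (proper⇒≤𝟘 z z<𝟙))

    𝓡-∂-shelling-stable : ∀ j {t} {G : Fin t → Carrier} {r} → IsShelling K (∂ K (F j)) G →
      (∀ x → (x ≤ F j × Initial K F (toℕ j) x) ⇔ Initial K G r x) → Stable (𝓡 K F j)
    𝓡-∂-shelling-stable j {G = G} {r} shelling F∩≡G =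
      simplex-minus-facets-stable (𝓡 K F j) (simplex j) (λ i → G i , G≤ i)
        -- Selecting the first `r` boundary facets makes the generated subcomplex `Initial K G r`.
        (λ i → toℕ i ℕ.<? r) (λ i → ∂-facet⇒⋖𝟙 (G-facet i) (G≤ i))
        λ (x , x≤Fj) → mk⇔ (λ init → Equivalence.to (F∩≡G x) (x≤Fj , init))
                           (λ init → proj₂ (Equivalence.from (F∩≡G x) init))
      where
      G-facet = IsFacetOrdering.facet (shelling⇒facetOrdering shelling)
      G≤ = λ i → proj₁ (proj₁ (G-facet i))

proposition3p2 : (K : PolytopalComplex) → IsSimplicial K → IsShellable K →
    (s : ℕ) (F : Fin s → PolytopalComplex.Carrier K) →
    IsShelling K U F → IsStableShelling K F
proposition3p2 K simplicial _ s F shelling = shelling , λ j → stable j (toℕ j ℕ.≟ 0) shelling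
  where
  ordering = shelling⇒facetOrdering K shelling

  stable : ∀ j → Dec (toℕ j ≡ 0) → IsShelling K U F → Stable (𝓡 K F j)
  stable j (yes j≡0) _ = 𝓡-first-stable K simplicial F ordering j j≡0
  stable j (no j≢0) (low d d≤0 pure _) =
    𝓡-low-stable K simplicial F ordering j
      (subst (ℤ._≤ 0ℤ) (sym (pure (F j) (IsFacetOrdering.facet ordering j))) d≤0)
      (ℕ.n≢0⇒n>0 j≢0)
  stable j (no j≢0) (high _ _ _ _ _ condition) =
    let _ , _ , _ , G-shelling , _ , _ , _ , F∩≡G = condition j (ℕ.n≢0⇒n>0 j≢0)
    in 𝓡-∂-shelling-stable K simplicial F ordering j G-shelling F∩≡G
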